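{- For every integer $m\ge 5$, $v(m)\ge m$, where $v(m)$ denotes the maximum number of vertices of an irreducible Tait colorable $m$-pole.
   Context: An $m$-pole ($m\ge 1$), or multipole, $M=(V,E,\mathcal{E})$ consists of a finite set $V=V(M)$ of vertices, a finite collection $E$ of edges (unordered pairs of vertices; parallel edges and loops may occur), and a set $\mathcal{E}=\{\epsilon_1,\dots,\epsilon_m\}$ of $m$ semiedges. Each semiedge is either incident to exactly one vertex, or is paired with another semiedge to form a free (isolated) edge, which has no vertices. All multipoles are cubic: for each vertex, the number of edges (loops counted twice) plus semiedges incident to it is $3$. A multipole may be disconnected, and $V$ may be empty. A Tait coloring of $M$ is a map $\phi:E\cup\mathcal{E}\to\{1,2,3\}$ such that the three edges/semiedges incident with any vertex receive distinct colors (so a multipole with a loop has none) and the two semiedges of any free edge receive the same color. $M$ is Tait colorable if it has a Tait coloring. $\mathrm{Col}(M)$ is the set of states of $M$, i.e. of tuples $(\phi(\epsilon_1),\dots,\phi(\epsilon_m))$ with $\phi$ a Tait coloring of $M$. An $m$-pole $M$ is reducible if there is an $m$-pole $N$ (with its semiedges numbered) such that $|V(N)|<|V(M)|$ and $\emptyset\ne\mathrm{Col}(N)\subseteq\mathrm{Col}(M)$; otherwise $M$ is irreducible. The maximum $v(m)$ is known to be finite. -}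

module Defs where

open import Data.Fin using (Fin)
open import Data.Nat using (ℕ; _≤_; _<_)
open import Data.Product using (_×_; _,_; ∃; ∃-syntax; proj₁; proj₂)
open import Data.Sum using (_⊎_; inj₁; inj₂)
open import Data.Vec using (Vec; tabulate)
open import Function.Bundles using (_↔_)
open import Function.Definitions using (Injective)
open import Level using (0ℓ)
open import Relation.Binary.PropositionalEquality using (_≡_; _≢_)
open import Relation.Nullary using (¬_)
open import Relation.Unary using (Pred; _⊆_; Satisfiable)

-- The edge and semiedge ends lying at vertex x.  An edge {u , w} is stored as
-- (u , w), the order being immaterial; a loop (x , x) has two ends at x, so it
-- counts twice in the degree.
data EndAt {n k m : ℕ} (edge : Fin k → Fin n × Fin n)
           (attach : Fin m → Fin n ⊎ Fin m) (x : Fin n) : Set where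
  fst  : (e : Fin k) → proj₁ (edge e) ≡ x → EndAt edge attach x
  snd  : (e : Fin k) → proj₂ (edge e) ≡ x → EndAt edge attach x
  semi : (i : Fin m) → attach i ≡ inj₁ x → EndAt edge attach x

-- Cubic m-poles.  attach i ≡ inj₁ x: semiedge i is incident to vertex x;
-- attach i ≡ inj₂ j: semiedges i and j together form a free edge.
record Multipole (m : ℕ) : Set where
  field
    order  : ℕ
    size   : ℕ
    edge   : Fin size → Fin order × Fin order
    attach : Fin m → Fin order ⊎ Fin m
    paired : ∀ i j → attach i ≡ inj₂ j → i ≢ j × attach j ≡ inj₂ i
    cubic  : ∀ x → Fin 3 ↔ EndAt edge attach x

  End : Fin order → Set
  End = EndAt edge attach

open Multipole public

Color : Set
Color = Fin 3

endColor : ∀ {m} (M : Multipole m) → (Fin (size M) → Color) → (Fin m → Color) →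
           ∀ {x} → End M x → Color
endColor M φE φS (fst e _)  = φE e
endColor M φE φS (snd e _)  = φE e
endColor M φE φS (semi i _) = φS i

-- Since both ends of a loop get the same color, properness excludes loops.
record TaitColoring {m : ℕ} (M : Multipole m) : Set where
  field
    edgeColor : Fin (size M) → Color
    semiColor : Fin m → Color
    proper    : ∀ x → Injective _≡_ _≡_ (endColor M edgeColor semiColor {x})
    free      : ∀ i j → attach M i ≡ inj₂ j → semiColor i ≡ semiColor j

open TaitColoring public

TaitColorable : ∀ {m} → Multipole m → Set
TaitColorable M = TaitColoring M

State : ℕ → Set
State m = Vec Color m

Col : ∀ {m} → Multipole m → Pred (State m) 0ℓ
Col M s = ∃[ φ ] tabulate (semiColor {M = M} φ) ≡ s

Reducible : ∀ {m} → Multipole m → Set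
Reducible {m} M =
  ∃[ N ] order {m} N < order M × Satisfiable (Col N) × Col N ⊆ Col M

Irreducible : ∀ {m} → Multipole m → Set
Irreducible M = ¬ Reducible M

IrreducibleColorable : ∀ {m} → Multipole m → Set
IrreducibleColorable M = Irreducible M × TaitColorable M

-- v(m) = v.  As a relation, because the finiteness of v(m) is a theorem.
IsMaxOrder : ℕ → ℕ → Set
IsMaxOrder m v =
  (∃[ M ] IrreducibleColorable {m} M × order M ≡ v) ×
  (∀ (M : Multipole m) → IrreducibleColorable M → order M ≤ v)

{-# OPTIONS --safe #-}
module Submission where

open import Defs
open import Data.Bool using (Bool; true; false; if_then_else_)
open import Data.Empty using (⊥; ⊥-elim)
open import Data.Fin using (Fin; zero; suc; _≟_; punchOut; fromℕ; inject₁; toℕ)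
open import Data.Fin.Properties using (all?; any?; suc-injective; pigeonhole; punchOut-injective;
  injective⇒≤; <⇒≢; fromℕ≢inject₁; inject₁-injective; toℕ-inject₁)
open import Data.Fin.Subset using (Subset; _-_; ⊤) renaming (_∈_ to _∈ₛ_; ∣_∣ to card)
open import Data.Fin.Subset.Properties using (x∈p∧x≢y⇒x∈p-y; x∈p⇒∣p-x∣<∣p∣; ∈⊤)
open import Data.List using (List; []; _∷_; _++_; length; tabulate; allFin)
open import Data.List.Membership.Propositional using (_∈_; _∉_)
import Data.List.Membership.DecPropositional as DecMembership
open import Data.List.Membership.Propositional.Properties using (∈-++⁺ˡ; ∈-++⁺ʳ; ∈-∃++; ∈-allFin)
open import Data.List.Properties using (length-tabulate; length-++)
open import Data.List.Relation.Binary.Permutation.Propositional using (_↭_; ↭-reflexive; ↭-trans; ↭⇒↭ₛ)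
open import Data.List.Relation.Binary.Permutation.Propositional.Properties
  using (++-comm; ∈-resp-↭; ↭-length)
import Data.List.Relation.Binary.Permutation.Setoid.Properties as PermutationSetoid
open import Data.List.Relation.Unary.All as All using (All; []; _∷_)
open import Data.List.Relation.Unary.All.Properties using (++⁻ˡ)
open import Data.List.Relation.Unary.AllPairs using ([]; _∷_)
open import Data.List.Relation.Unary.Any using (here; there)
open import Data.List.Relation.Unary.Unique.Propositional using (Unique)
open import Data.List.Relation.Unary.Unique.Propositional.Properties using (allFin⁺)
open import Data.Nat using (ℕ; zero; suc; _+_; _≤_; _<_; s≤s)
open import Data.Nat.Induction using (<-wellFounded)
open import Data.Nat.Properties using (≤-refl; <-irrefl; +-comm; +-suc)
open import Data.Product using (_×_; _,_; ∃; ∃-syntax; proj₁; proj₂)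
open import Data.Sum using (_⊎_; inj₁; inj₂; [_,_])
open import Data.Sum.Properties using (≡-dec; inj₁-injective; inj₂-injective)
import Data.Vec as Vec
open import Data.Vec.Properties using (lookup∘tabulate)
open import Function using (_∘_; id; case_of_; Injective; _↔_)
open import Function.Bundles using (mk↔ₛ′; module Inverse; module Injection)
open import Function.Properties.Inverse using (Inverse⇒Injection)
open import Induction.WellFounded using (Acc; acc)
open import Relation.Binary.PropositionalEquality hiding ([_])
open import Relation.Nullary using (¬_; Dec; yes; no; does; contradiction; ¬?; _→-dec_; _×-dec_; _⊎-dec_)
open import Relation.Nullary.Decidable using (from-yes)

-- The m-cycle with one semiedge at each vertex is irreducible.  Regard the
-- colors as the nonzero elements of the Klein four-group.  A state of the cycle
-- is a sequence of colors for which some starting point makes all partial sums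
-- (the colors of the cycle edges) nonzero and the sum closed.
--
-- If N has fewer than m vertices, then by the pigeonhole principle either two
-- semiedges i and k of N form a free edge, and always have equal colors, or they
-- share a vertex, and always have different colors.  In both cases a Kempe switch
-- of N starting at i ends at k and leaves the other semiedges alone.  If both
-- states occur in the cycle, the two sequences of partial sums differ by constants
-- on the two arcs between i and k, and a nonzero difference δ forces every semiedge
-- of the arc to have color δ.  As m ≥ 5 one arc contains at least two semiedges, and
-- Kempe switches starting at the first semiedge of an arc destroy this rigid pattern.

-- Colors and the Klein four-group

infixl 7 _▹_
infixl 6 _⊕_

-- a ▹ d is a with the two colors other than d interchanged.
_▹_ : Color → Color → Color
zero           ▹ zero           = zero
zero           ▹ suc zero       = suc (suc zero)
zero           ▹ suc (suc zero) = suc zero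
suc zero       ▹ zero           = suc (suc zero)
suc zero       ▹ suc zero       = suc zero
suc zero       ▹ suc (suc zero) = zero
suc (suc zero) ▹ zero           = suc zero
suc (suc zero) ▹ suc zero       = zero
suc (suc zero) ▹ suc (suc zero) = suc (suc zero)

-- zero is the neutral element; the color c is the element suc c.
Klein : Set
Klein = Fin 4

_⊕_ : Klein → Klein → Klein
zero ⊕ y = y
suc a ⊕ zero = suc a
suc zero ⊕ suc zero = zero
suc zero ⊕ suc (suc zero) = suc (suc (suc zero))
suc zero ⊕ suc (suc (suc zero)) = suc (suc zero)
suc (suc zero) ⊕ suc zero = suc (suc (suc zero))
suc (suc zero) ⊕ suc (suc zero) = zero
suc (suc zero) ⊕ suc (suc (suc zero)) = suc zero
suc (suc (suc zero)) ⊕ suc zero = suc (suc zero)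
suc (suc (suc zero)) ⊕ suc (suc zero) = suc zero
suc (suc (suc zero)) ⊕ suc (suc (suc zero)) = zero

abstract
  ⊕-assoc : ∀ x y z → (x ⊕ y) ⊕ z ≡ x ⊕ (y ⊕ z)
  ⊕-assoc = from-yes (all? λ x → all? λ y → all? λ z → (x ⊕ y) ⊕ z ≟ x ⊕ (y ⊕ z))

  ⊕-comm : ∀ x y → x ⊕ y ≡ y ⊕ x
  ⊕-comm = from-yes (all? λ x → all? λ y → x ⊕ y ≟ y ⊕ x)

  ⊕-identityʳ : ∀ x → x ⊕ zero ≡ x
  ⊕-identityʳ = from-yes (all? λ x → x ⊕ zero ≟ x)

  ▹-⊕ : ∀ a d → a ≢ d → suc (a ▹ d) ≡ suc a ⊕ suc d
  ▹-⊕ = from-yes (all? λ a → all? λ d → ¬? (a ≟ d) →-dec (suc (a ▹ d) ≟ suc a ⊕ suc d))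

  ▹-idem : ∀ a → a ▹ a ≡ a
  ▹-idem = from-yes (all? λ a → a ▹ a ≟ a)

  ▹-involutive : ∀ a d → a ▹ d ▹ d ≡ a
  ▹-involutive = from-yes (all? λ a → all? λ d → a ▹ d ▹ d ≟ a)

  ▹-moves : ∀ a d → a ≢ d → a ▹ d ≢ a × a ▹ d ≢ d
  ▹-moves = from-yes (all? λ a → all? λ d → ¬? (a ≟ d) →-dec (¬? (a ▹ d ≟ a) ×-dec ¬? (a ▹ d ≟ d)))

  ▹-swap : ∀ a b → a ▹ (a ▹ b) ≡ b
  ▹-swap = from-yes (all? λ a → all? λ b → a ▹ (a ▹ b) ≟ b)

  ▹-only-two : ∀ a b d → a ≢ d → b ≢ d → a ≢ b → b ≡ a ▹ d
  ▹-only-two = from-yes (all? λ a → all? λ b → all? λ d →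
    ¬? (a ≟ d) →-dec (¬? (b ≟ d) →-dec (¬? (a ≟ b) →-dec (b ≟ a ▹ d))))

  -- f and f′ are the partial sums before semiedge i, for a state with colors a, b
  -- at i, k and for the state with a, b exchanged; s is the sum over the arc from i
  -- to k.  The partial sums of the two states differ by δᵢ on this arc and by δₒ on
  -- the other one, where δᵢ ⊕ δₒ = a ⊕ b; the cases are δₒ = 0, δᵢ = 0, neither.
  cherry-cases : ∀ (f f′ : Klein) (a b : Color) (s : Klein) → a ≢ b →
    f ≢ zero → f ⊕ suc a ≢ zero → f ⊕ suc a ⊕ s ≢ zero → f ⊕ suc a ⊕ s ⊕ suc b ≢ zero →
    f′ ≢ zero → f′ ⊕ suc b ≢ zero → f′ ⊕ suc b ⊕ s ≢ zero → f′ ⊕ suc b ⊕ s ⊕ suc a ≢ zero →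
    let δᵢ = f ⊕ suc a ⊕ (f′ ⊕ suc b) ; δₒ = f ⊕ f′ in
    (δᵢ ≢ zero × s ≡ δᵢ × δᵢ ≡ suc a ⊕ suc b) ⊎
    (δₒ ≢ zero × suc a ⊕ s ⊕ suc b ≡ δₒ × s ≡ zero) ⊎
    (δᵢ ≢ zero × s ≡ δᵢ × δₒ ≢ zero × suc a ⊕ s ⊕ suc b ≡ δₒ)
  cherry-cases = from-yes (all? λ f → all? λ f′ → all? λ a → all? λ b → all? λ s →
    let δᵢ = f ⊕ suc a ⊕ (f′ ⊕ suc b) ; δₒ = f ⊕ f′ ; σₒ = suc a ⊕ s ⊕ suc b in
    ¬? (a ≟ b) →-dec
    ¬? (f ≟ zero) →-dec ¬? (f ⊕ suc a ≟ zero) →-dec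
    ¬? (f ⊕ suc a ⊕ s ≟ zero) →-dec ¬? (f ⊕ suc a ⊕ s ⊕ suc b ≟ zero) →-dec
    ¬? (f′ ≟ zero) →-dec ¬? (f′ ⊕ suc b ≟ zero) →-dec
    ¬? (f′ ⊕ suc b ⊕ s ≟ zero) →-dec ¬? (f′ ⊕ suc b ⊕ s ⊕ suc a ≟ zero) →-dec
    (¬? (δᵢ ≟ zero) ×-dec s ≟ δᵢ ×-dec δᵢ ≟ suc a ⊕ suc b ⊎-dec
     ¬? (δₒ ≟ zero) ×-dec σₒ ≟ δₒ ×-dec s ≟ zero ⊎-dec
     ¬? (δᵢ ≟ zero) ×-dec s ≟ δᵢ ×-dec ¬? (δₒ ≟ zero) ×-dec σₒ ≟ δₒ))

  -- Here `f` and `f′` are two different nonzero elements, and `suc s` is neither of them because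
  -- neither sum vanishes. The only nonzero element left is `f ⊕ f′`.
  ⊕-mono : ∀ f f′ s → f ≢ zero → f′ ≢ zero → f ⊕ suc s ≢ zero → f′ ⊕ suc s ≢ zero →
           f ⊕ f′ ≢ zero → suc s ≡ f ⊕ f′
  ⊕-mono = from-yes (all? λ f → all? λ f′ → all? λ s →
    ¬? (f ≟ zero) →-dec ¬? (f′ ≟ zero) →-dec ¬? (f ⊕ suc s ≟ zero) →-dec ¬? (f′ ⊕ suc s ≟ zero) →-dec
    ¬? (f ⊕ f′ ≟ zero) →-dec suc s ≟ f ⊕ f′)

  ⊕-translate : ∀ f f′ s → (f ⊕ s) ⊕ (f′ ⊕ s) ≡ f ⊕ f′
  ⊕-translate = from-yes (all? λ f → all? λ f′ → all? λ s → (f ⊕ s) ⊕ (f′ ⊕ s) ≟ f ⊕ f′)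

  -- For `a ≢ b` the elements `f`, `f ⊕ suc a`, `f ⊕ suc a ⊕ suc b` and `f ⊕ suc b` are the whole
  -- group, so one of them is zero.
  no-square : ∀ f a b → a ≢ b → f ≢ zero → f ⊕ suc a ≢ zero → f ⊕ suc a ⊕ suc b ≢ zero →
              f ⊕ suc b ≢ zero → ⊥
  no-square = from-yes (all? λ f → all? λ a → all? λ b →
    ¬? (a ≟ b) →-dec ¬? (f ≟ zero) →-dec ¬? (f ⊕ suc a ≟ zero) →-dec ¬? (f ⊕ suc a ⊕ suc b ≟ zero) →-dec
    ¬? (¬? (f ⊕ suc b ≟ zero)))

  ⊕-conjugate : ∀ f a t → f ⊕ a ⊕ t ⊕ a ≡ f ⊕ t
  ⊕-conjugate = from-yes (all? λ f → all? λ a → all? λ t → f ⊕ a ⊕ t ⊕ a ≟ f ⊕ t)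

  ⊕-cancel : ∀ x s → x ⊕ s ≡ x → s ≡ zero
  ⊕-cancel = from-yes (all? λ x → all? λ s → x ⊕ s ≟ x →-dec s ≟ zero)

abstract
  -- If the three sums had a common value, it would be nonzero since the sums are, hence it would be
  -- the element of some color `c`; then the `f` belonging to `c` would be zero.
  spread₃ : ∀ f₀ f₁ f₂ → f₀ ≢ zero → f₁ ≢ zero → f₂ ≢ zero →
    f₀ ⊕ suc zero ≢ zero → f₁ ⊕ suc (suc zero) ≢ zero → f₂ ⊕ suc (suc (suc zero)) ≢ zero →
    (f₀ ⊕ suc zero) ⊕ (f₁ ⊕ suc (suc zero)) ≢ zero ⊎
    (f₀ ⊕ suc zero) ⊕ (f₂ ⊕ suc (suc (suc zero))) ≢ zero
  spread₃ = from-yes (all? λ f₀ → all? λ f₁ → all? λ f₂ →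
    ¬? (f₀ ≟ zero) →-dec ¬? (f₁ ≟ zero) →-dec ¬? (f₂ ≟ zero) →-dec
    ¬? (f₀ ⊕ suc zero ≟ zero) →-dec ¬? (f₁ ⊕ suc (suc zero) ≟ zero) →-dec
    ¬? (f₂ ⊕ suc (suc (suc zero)) ≟ zero) →-dec
    (¬? ((f₀ ⊕ suc zero) ⊕ (f₁ ⊕ suc (suc zero)) ≟ zero) ⊎-dec
     ¬? ((f₀ ⊕ suc zero) ⊕ (f₂ ⊕ suc (suc (suc zero))) ≟ zero)))

spread : ∀ (f : Color → Klein) → (∀ c → f c ≢ zero) → (∀ c → f c ⊕ suc c ≢ zero) →
         ∃[ c ] ∃[ c′ ] (f c ⊕ suc c) ⊕ (f c′ ⊕ suc c′) ≢ zero
spread f p q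
  with spread₃ (f zero) (f (suc zero)) (f (suc (suc zero)))
         (p zero) (p (suc zero)) (p (suc (suc zero))) (q zero) (q (suc zero)) (q (suc (suc zero)))
... | inj₁ r = zero , suc zero , r
... | inj₂ r = zero , suc (suc zero) , r

abstract
  ⊕-solve : ∀ f g o → f ≡ g ⊕ o → o ≡ f ⊕ g
  ⊕-solve = from-yes (all? λ f → all? λ g → all? λ o → f ≟ g ⊕ o →-dec o ≟ f ⊕ g)

  ⊕-cancelˡ : ∀ f g → f ⊕ (f ⊕ g) ≡ g
  ⊕-cancelˡ = from-yes (all? λ f → all? λ g → f ⊕ (f ⊕ g) ≟ g)

  ⊕-reverse : ∀ a s b → b ⊕ s ⊕ a ≡ a ⊕ s ⊕ b
  ⊕-reverse = from-yes (all? λ a → all? λ s → all? λ b → b ⊕ s ⊕ a ≟ a ⊕ s ⊕ b)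

⊕-assoc₃ : ∀ f a s b → f ⊕ a ⊕ s ⊕ b ≡ f ⊕ (a ⊕ s ⊕ b)
⊕-assoc₃ f a s b = trans (cong (_⊕ b) (⊕-assoc f a s)) (⊕-assoc f (a ⊕ s) b)

outer-sum : ∀ f a s b o → f ≡ f ⊕ a ⊕ s ⊕ b ⊕ o → o ≡ a ⊕ s ⊕ b
outer-sum f a s b o e = trans (⊕-solve f (f ⊕ a ⊕ s ⊕ b) o e)
  (trans (cong (f ⊕_) (⊕-assoc₃ f a s b)) (⊕-cancelˡ f (a ⊕ s ⊕ b)))

-- Exchanging the colors `a` and `b` at the two ends of an arc does not change the total over the
-- arc and its ends, so the difference after `k` is again the one before `i`.
shift-outer : ∀ f f′ a s b → (f ⊕ a ⊕ s ⊕ b) ⊕ (f′ ⊕ b ⊕ s ⊕ a) ≡ f ⊕ f′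
shift-outer f f′ a s b = trans (cong₂ _⊕_ (⊕-assoc₃ f a s b)
  (trans (⊕-assoc₃ f′ b s a) (cong (f′ ⊕_) (⊕-reverse a s b)))) (⊕-translate f f′ (a ⊕ s ⊕ b))

abstract
  ▹-⊕-cancel : ∀ c d → c ≢ d → suc (c ▹ d) ⊕ suc d ≡ suc c
  ▹-⊕-cancel = from-yes (all? λ c → all? λ d → ¬? (c ≟ d) →-dec suc (c ▹ d) ⊕ suc d ≟ suc c)

  -- The partial sums f, f + a, f + a + c, f + c exhaust the group when a + b = c.
  no-rainbow : ∀ f a b c → a ≢ b → suc c ≡ suc a ⊕ suc b → f ≢ zero → f ⊕ suc a ≢ zero →
               f ⊕ suc a ⊕ suc c ≢ zero → f ⊕ suc a ⊕ suc c ⊕ suc b ⊕ suc c ≢ zero → ⊥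
  no-rainbow = from-yes (all? λ f → all? λ a → all? λ b → all? λ c →
    ¬? (a ≟ b) →-dec suc c ≟ suc a ⊕ suc b →-dec ¬? (f ≟ zero) →-dec ¬? (f ⊕ suc a ≟ zero) →-dec
    ¬? (f ⊕ suc a ⊕ suc c ≟ zero) →-dec ¬? (¬? (f ⊕ suc a ⊕ suc c ⊕ suc b ⊕ suc c ≟ zero)))

  ▹-swap′ : ∀ a b → b ▹ (a ▹ b) ≡ a
  ▹-swap′ = from-yes (all? λ a → all? λ b → b ▹ (a ▹ b) ≟ a)

  ▹-fresh : ∀ a b → a ≢ b → a ≢ a ▹ b
  ▹-fresh = from-yes (all? λ a → all? λ b → ¬? (a ≟ b) →-dec ¬? (a ≟ a ▹ b))

another : Color → Color
another zero = suc zero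
another (suc _) = zero

abstract
  another-≢ : ∀ a → a ≢ another a
  another-≢ = from-yes (all? λ a → ¬? (a ≟ another a))

-- States of the cycle and Kempe switches

module _ {m : ℕ} where

  infixr 5 _∷_

  -- The indices are the first and the last partial sum.
  data Walk (φ : Fin m → Color) : Klein → List (Fin m) → Klein → Set where
    []  : ∀ {f} → f ≢ zero → Walk φ f [] f
    _∷_ : ∀ {f j L h} → f ≢ zero → Walk φ (f ⊕ suc (φ j)) L h → Walk φ f (j ∷ L) h

  sum : (Fin m → Color) → List (Fin m) → Klein
  sum φ []      = zero
  sum φ (j ∷ L) = suc (φ j) ⊕ sum φ L

  Closed : (Fin m → Color) → List (Fin m) → Set
  Closed φ L = ∃[ f ] Walk φ f L f

  Agree : (φ φ′ : Fin m → Color) → List (Fin m) → Set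
  Agree φ φ′ L = ∀ {z} → z ∈ L → φ′ z ≡ φ z

  module _ {φ : Fin m → Color} where

    walk-start : ∀ {f L h} → Walk φ f L h → f ≢ zero
    walk-start ([] f≢0)  = f≢0
    walk-start (f≢0 ∷ _) = f≢0

    walk-end : ∀ {f L h} → Walk φ f L h → h ≡ f ⊕ sum φ L
    walk-end ([] _) = sym (⊕-identityʳ _)
    walk-end {f} {j ∷ L} (_ ∷ w) = trans (walk-end w) (⊕-assoc f (suc (φ j)) (sum φ L))

    walk-++⁻ : ∀ {f h} A {B} → Walk φ f (A ++ B) h → Walk φ f A (f ⊕ sum φ A) × Walk φ (f ⊕ sum φ A) B h
    walk-++⁻ {f} [] w rewrite ⊕-identityʳ f = [] (walk-start w) , w
    walk-++⁻ {f} (j ∷ A) (f≢0 ∷ w) with walk-++⁻ A w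
    ... | u , v rewrite ⊕-assoc f (suc (φ j)) (sum φ A) = f≢0 ∷ u , v

    walk-++⁺ : ∀ {f g h A B} → Walk φ f A g → Walk φ g B h → Walk φ f (A ++ B) h
    walk-++⁺ ([] _)    v = v
    walk-++⁺ (f≢0 ∷ u) v = f≢0 ∷ walk-++⁺ u v

    closed-rotate : ∀ A {B} → Closed φ (A ++ B) → Closed φ (B ++ A)
    closed-rotate A (f , w) with walk-++⁻ A w
    ... | u , v = _ , walk-++⁺ v u

    -- Both walks add the same colors, so their difference stays `f ⊕ f′` throughout, and `⊕-mono`
    -- forces each step to be that difference.
    walk-mono : ∀ {f f′ L h h′} → Walk φ f L h → Walk φ f′ L h′ → f ⊕ f′ ≢ zero →
                All (λ j → suc (φ j) ≡ f ⊕ f′) L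
    walk-mono ([] _) ([] _) _ = []
    walk-mono {f} {f′} {j ∷ L} (p ∷ w) (p′ ∷ w′) δ≢0 =
      ⊕-mono f f′ (φ j) p p′ (walk-start w) (walk-start w′) δ≢0 ∷
      subst (λ δ → All (λ j → suc (φ j) ≡ δ) L) shift (walk-mono w w′ (δ≢0 ∘ trans (sym shift)))
      where shift = ⊕-translate f f′ (suc (φ j))

  walk-agree : ∀ {φ φ′ f L h} → Agree φ φ′ L → Walk φ′ f L h → Walk φ f L h
  walk-agree eq ([] f≢0) = [] f≢0
  walk-agree {f = f} {h = h} eq (_∷_ {L = L} f≢0 w) =
    f≢0 ∷ walk-agree (eq ∘ there) (subst (λ c → Walk _ (f ⊕ suc c) L h) (eq (here refl)) w)

  sum-agree : ∀ {φ φ′} L → Agree φ φ′ L → sum φ′ L ≡ sum φ L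
  sum-agree []      eq = refl
  sum-agree (j ∷ L) eq = cong₂ (λ c s → suc c ⊕ s) (eq (here refl)) (sum-agree L (eq ∘ there))

  -- The effect of a Kempe switch in the two colors other than d, along the chain
  -- joining the semiedges j and y.
  record Flip (d : Color) (j y : Fin m) (φ φ′ : Fin m → Color) : Set where
    field
      distinct : y ≢ j
      movable  : φ y ≢ d
      source   : φ′ j ≡ φ j ▹ d
      target   : φ′ y ≡ φ y ▹ d
      fixed    : ∀ {z} → z ≢ j → z ≢ y → φ′ z ≡ φ z

  open Flip

  -- In the application `S` is the set of states of N. The argument on arcs sees N only through this
  -- closure property, the linked pair of semiedges and the inclusion in the states of the cycle.
  KempeClosed : ((Fin m → Color) → Set) → Set
  KempeClosed S = ∀ d j {φ} → S φ → φ j ≢ d → ∃[ y ] ∃[ φ′ ] Flip d j y φ φ′ × S φ′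

  -- Only the term of `y` changes, and switching a color other than `d` adds `d` to it.
  sum-flip : ∀ {d j y φ φ′} → Flip d j y φ φ′ → ∀ {L} → j ∉ L → Unique L → y ∈ L →
             sum φ′ L ≡ suc d ⊕ sum φ L
  sum-flip {d} {φ = φ} fl {z ∷ L} j∉ (z∉ ∷ _) (here refl) =
    trans (cong₂ _⊕_ (trans (cong suc (target fl)) (trans (▹-⊕ _ d (movable fl)) (⊕-comm _ (suc d))))
                     (sum-agree L λ z∈ → fixed fl (λ where refl → j∉ (there z∈)) (λ where refl → All.lookup z∉ z∈ refl)))
          (⊕-assoc (suc d) (suc (φ z)) (sum φ L))
  sum-flip {d} {φ = φ} fl {z ∷ L} j∉ (z∉ ∷ u) (there y∈) =
    trans (cong₂ _⊕_ (cong suc (fixed fl (λ where refl → j∉ (here refl)) (All.lookup z∉ y∈)))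
                     (sum-flip fl (j∉ ∘ there) u y∈))
     (trans (sym (⊕-assoc (suc (φ z)) (suc d) _))
     (trans (cong (_⊕ sum φ L) (⊕-comm (suc (φ z)) (suc d))) (⊕-assoc (suc d) (suc (φ z)) _)))

  open DecMembership (_≟_ {m}) using (_∈?_)

  unique-++⁻ : ∀ A {B : List (Fin m)} → Unique (A ++ B) → Unique A × (∀ {y} → y ∈ A → y ∉ B)
  unique-++⁻ []      _        = [] , λ ()
  unique-++⁻ (x ∷ A) (x∉ ∷ u) with unique-++⁻ A u
  ... | uA , disjoint = ++⁻ˡ A x∉ ∷ uA , λ where
    (here refl) y∈B → All.lookup x∉ (∈-++⁺ʳ A y∈B) refl
    (there y∈A) → disjoint y∈A

  Unique-resp-↭ : ∀ {A B : List (Fin m)} → A ↭ B → Unique A → Unique B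
  Unique-resp-↭ p = PermutationSetoid.Unique-resp-↭ (setoid (Fin m)) (↭⇒↭ₛ p)

  -- The two arcs between a pair of semiedges

  module _ (S : (Fin m → Color) → Set) (kempe : KempeClosed S) where

    -- V and O are the two arcs into which i and k cut the cyclic order.
    record Arcs (i : Fin m) (V : List (Fin m)) (k : Fin m) (O : List (Fin m)) : Set where
      field
        closed : ∀ {φ} → S φ → Closed φ (i ∷ V ++ k ∷ O)
        unique : Unique (i ∷ V ++ k ∷ O)

    open Arcs

    -- A closed walk may start anywhere, so the arcs play symmetric roles and each result about `V`
    -- transfers to `O`.
    arcs-rotate : ∀ {i V k O} → Arcs i V k O → Arcs k O i V
    arcs-rotate {i} {V} {k} {O} ar = record
      { closed = λ s → closed-rotate (i ∷ V) (closed ar s)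
      ; unique = Unique-resp-↭ perm (unique ar)
      }
      where perm = ++-comm (i ∷ V) (k ∷ O)

    module ArcFrom {i V k O} (ar : Arcs i V k O) where

      i∉ : All (i ≢_) (V ++ k ∷ O)
      i∉ with unique ar
      ... | p ∷ _ = p

      uniqueV : Unique V
      uniqueV with unique ar
      ... | _ ∷ u = proj₁ (unique-++⁻ V u)

      V#k∷O : ∀ {y} → y ∈ V → y ∉ k ∷ O
      V#k∷O with unique ar
      ... | _ ∷ u = proj₂ (unique-++⁻ V u)

      i∉V : i ∉ V
      i∉V i∈ = All.lookup i∉ (∈-++⁺ˡ i∈) refl

      i∉k∷O : i ∉ k ∷ O
      i∉k∷O i∈ = All.lookup i∉ (∈-++⁺ʳ V i∈) refl

    module ArcFacts {i V k O} (ar : Arcs i V k O) where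
      open ArcFrom ar public
      open ArcFrom (arcs-rotate ar) public using ()
        renaming (i∉V to k∉O; i∉k∷O to k∉i∷V)

      agreeV : ∀ {d φ φ′} → Flip d i k φ φ′ → Agree φ φ′ V
      agreeV fl z∈ = fixed fl (λ where refl → i∉V z∈) (λ where refl → k∉i∷V (there z∈))

      agreeO : ∀ {d φ φ′} → Flip d i k φ φ′ → Agree φ φ′ O
      agreeO fl z∈ = fixed fl (λ where refl → i∉k∷O (there z∈)) (λ where refl → k∉O z∈)

      record Steps (φ : Fin m → Color) (f : Klein) : Set where
        field
          start   : f ≢ zero
          inner   : Walk φ (f ⊕ suc (φ i)) V (f ⊕ suc (φ i) ⊕ sum φ V)
          mid     : f ⊕ suc (φ i) ⊕ sum φ V ≢ zero
          outer   : Walk φ (f ⊕ suc (φ i) ⊕ sum φ V ⊕ suc (φ k)) O f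
          returns : f ≡ f ⊕ suc (φ i) ⊕ sum φ V ⊕ suc (φ k) ⊕ sum φ O

      steps : ∀ {φ} → S φ → ∃ (Steps φ)
      steps sφ with closed ar sφ
      ... | f , p ∷ w with walk-++⁻ V w
      ... | u , q ∷ v = f , record { start = p ; inner = u ; mid = q ; outer = v ; returns = walk-end v }

    -- The condition on the sum says that the length is odd.
    Mono : (Fin m → Color) → List (Fin m) → Set
    Mono φ L = ∃[ c ] All (λ j → φ j ≡ c) L × sum φ L ≡ suc c

    mono : ∀ {φ L} δ → δ ≢ zero → (δ ≢ zero → All (λ j → suc (φ j) ≡ δ) L) → sum φ L ≡ δ → Mono φ L
    mono zero    δ≢0 _ _ = contradiction refl δ≢0
    mono (suc c) δ≢0 p q = c , All.map suc-injective (p δ≢0) , q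

    Differ Same : Fin m → Fin m → Set
    Differ i k = ∀ {φ} → S φ → φ i ≢ φ k
    Same i k = ∀ {φ} → S φ → φ i ≡ φ k

    -- Semiedges with always different colors

    module Cherry {i V k O} (ar : Arcs i V k O) (differ : Differ i k) where
      open ArcFacts ar

      -- The switch starting at i ends at k, since otherwise φ′ i ≡ φ′ k.
      swap : ∀ {φ} → S φ → ∃[ φ′ ] S φ′ × φ′ i ≡ φ k × φ′ k ≡ φ i × Agree φ φ′ V × Agree φ φ′ O
      swap {φ} sφ with kempe (φ i ▹ φ k) i sφ (▹-fresh _ _ (differ sφ))
      ... | y , φ′ , fl , sφ′ with trans (source fl) (▹-swap (φ i) (φ k)) | k ≟ y
      ... | e | no k≢y = contradiction (trans e (sym (fixed fl (λ where refl → i∉k∷O (here refl)) k≢y))) (differ sφ′)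
      ... | e | yes refl = φ′ , sφ′ , e , trans (target fl) (▹-swap′ (φ i) (φ k)) , agreeV fl , agreeO fl

      -- The state and its swap agree on both arcs, so on each arc their partial sums differ by a
      -- constant. Where it is nonzero, `walk-mono` makes the arc constant; `cherry-cases` lists
      -- which of the two constants can vanish.
      arc-types : ∀ {φ} → S φ →
        (Mono φ V × sum φ V ≡ suc (φ i) ⊕ suc (φ k)) ⊎
        (Mono φ O × sum φ V ≡ zero) ⊎
        (Mono φ V × Mono φ O)
      arc-types {φ} sφ with swap sφ
      ... | φ′ , sφ′ , ei , ek , aV , aO with steps sφ | steps sφ′
      ... | f , st | f′ , st′ with Steps.start st | Steps.start st′ | Steps.inner st | walk-agree aV (Steps.inner st′)
                                 | Steps.mid st | Steps.mid st′ | Steps.outer st | walk-agree aO (Steps.outer st′)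
      ... | p | p′ | u | u′ | q | q′ | v | v′ rewrite ei | ek | sum-agree V aV =
        conclude (cherry-cases f f′ (φ i) (φ k) (sum φ V) (differ sφ)
          p (walk-start u) q (walk-start v) p′ (walk-start u′) q′ (walk-start v′))
        where
        sumO : ∀ {δ} → suc (φ i) ⊕ sum φ V ⊕ suc (φ k) ≡ δ → sum φ O ≡ δ
        sumO e = trans (outer-sum f (suc (φ i)) (sum φ V) (suc (φ k)) (sum φ O) (Steps.returns st)) e
        monoV = mono (f ⊕ suc (φ i) ⊕ (f′ ⊕ suc (φ k)))
        monoO : f ⊕ f′ ≢ zero → suc (φ i) ⊕ sum φ V ⊕ suc (φ k) ≡ f ⊕ f′ → Mono φ O
        monoO δ≢0 e = mono (f ⊕ f′) δ≢0
          (subst (λ δ → δ ≢ zero → All (λ j → suc (φ j) ≡ δ) O)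
                 (shift-outer f f′ (suc (φ i)) (sum φ V) (suc (φ k))) (walk-mono v v′)) (sumO e)
        conclude : _ → _
        conclude (inj₁ (δ≢0 , e , e′))             = inj₁ (monoV δ≢0 (walk-mono u u′) e , trans e e′)
        conclude (inj₂ (inj₁ (δ≢0 , e , e′)))      = inj₂ (inj₁ (monoO δ≢0 e , e′))
        conclude (inj₂ (inj₂ (δ≢0 , e , ε≢0 , e′))) = inj₂ (inj₂ (monoV δ≢0 (walk-mono u u′) e , monoO ε≢0 e′))

      inner-cases : ∀ {φ} → S φ → Mono φ V ⊎ sum φ V ≡ zero
      inner-cases sφ with arc-types sφ
      ... | inj₁ (μ , _)        = inj₁ μ
      ... | inj₂ (inj₁ (_ , e)) = inj₂ e
      ... | inj₂ (inj₂ (μ , _)) = inj₁ μ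

      -- A switch starting at j breaks constancy of V but keeps its sum nonzero.
      long-arc : ∀ {φ j z W} → V ≡ j ∷ z ∷ W → S φ → ¬ Mono φ V
      long-arc {φ} {j} {z} {W} refl sφ (c , pj ∷ pz ∷ _ , total) =
        refute (kempe d j sφ (λ e → another-≢ c (trans (sym pj) e)))
        where
        d = another c
        x≢c : c ▹ d ≢ c
        x≢c = proj₁ (▹-moves c d (another-≢ c))
        tail : sum φ (z ∷ W) ≡ zero
        tail = ⊕-cancel (suc c) (sum φ (z ∷ W)) (trans (cong (λ a → suc a ⊕ sum φ (z ∷ W)) (sym pj)) total)
        j∉ : j ∉ z ∷ W
        j∉ j∈ with uniqueV
        ... | p ∷ _ = All.lookup p j∈ refl
        uniqueT : Unique (z ∷ W)
        uniqueT with uniqueV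
        ... | _ ∷ u = u
        refute : ¬ (∃[ y ] ∃[ φ′ ] Flip d j y φ φ′ × S φ′)
        refute (y , φ′ , fl , sφ′) with trans (source fl) (cong (_▹ d) pj) | y ∈? (z ∷ W) | inner-cases sφ′
        -- The chain ends inside the arc: the two changes cancel in the sum, which stays `suc c`,
        -- although `j` no longer has color `c`.
        ... | e | yes y∈ | cases = clash cases
          where
          total′ : sum φ′ (j ∷ z ∷ W) ≡ suc c
          total′ = trans (cong₂ (λ a s → suc a ⊕ s) e (trans (sum-flip fl j∉ uniqueT y∈) (cong (suc d ⊕_) tail)))
                         (▹-⊕-cancel c d (another-≢ c))
          clash : ¬ (Mono φ′ (j ∷ z ∷ W) ⊎ sum φ′ (j ∷ z ∷ W) ≡ zero)
          clash (inj₁ (c′ , pj′ ∷ _ , t)) =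
            x≢c (trans (sym e) (trans pj′ (suc-injective (trans (sym t) total′))))
          clash (inj₂ t) with trans (sym total′) t
          ... | ()
        -- The chain leaves the arc: `z` keeps color `c` while `j` loses it, and the sum of the arc
        -- is the color of `j` alone, hence nonzero.
        ... | e | no y∉ | inj₁ (c′ , pj′ ∷ pz′ ∷ _ , _) =
          x≢c (trans (sym e) (trans pj′ (trans (sym pz′) (trans (fixed fl (λ where refl → j∉ (here refl))
                                                                          (λ where refl → y∉ (here refl))) pz))))
        ... | e | no y∉ | inj₂ t with trans (sym (cong (suc (φ′ j) ⊕_) (trans (sum-agree (z ∷ W) (λ x∈ →
                fixed fl (λ where refl → j∉ x∈) (λ where refl → y∉ x∈))) tail))) t
        ... | ()

    module CherryLongArc {i V k w w′ O} (ar : Arcs i V k (w ∷ w′ ∷ O)) (differ : Differ i k) where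
      open ArcFacts ar
      open Cherry ar differ
      module Rotated = Cherry (arcs-rotate ar) (λ sφ e → differ sφ (sym e))

      -- The outer arc has at least two semiedges, so `long-arc` excludes the types in which it is
      -- constant.
      sumV : ∀ {φ} → S φ → Mono φ V × sum φ V ≡ suc (φ i) ⊕ suc (φ k)
      sumV sφ with arc-types sφ
      ... | inj₁ r              = r
      ... | inj₂ (inj₁ (μ , _)) = contradiction μ (Rotated.long-arc refl sφ)
      ... | inj₂ (inj₂ (_ , μ)) = contradiction μ (Rotated.long-arc refl sφ)

      impossible : ∀ {φ} → ¬ S φ
      impossible {φ} sφ = by-length V refl (proj₁ (sumV sφ))
        where
        third : ∀ {j} → V ≡ j ∷ [] → ∀ {φ} → S φ → suc (φ j) ≡ suc (φ i) ⊕ suc (φ k)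
        third refl sφ = proj₂ (sumV sφ)
        -- If `w` had the color of `j`, the partial sums before `i` and after `i`, `j` and `w` would
        -- be all four group elements.
        separated : ∀ {j} → V ≡ j ∷ [] → ∀ {φ} → S φ → φ j ≢ φ w
        separated {j} refl {φ} sφ e with steps sφ
        ... | f , st with Steps.outer st
        ... | _ ∷ v = no-rainbow f (φ i) (φ k) (φ j) (differ sφ) (third refl sφ)
          (Steps.start st) (walk-start (Steps.inner st)) (Steps.mid st)
          (subst (λ c → f ⊕ suc (φ i) ⊕ suc (φ j) ⊕ suc (φ k) ⊕ suc c ≢ zero) (sym e) (walk-start v))
        single : ∀ {j} → V ≡ j ∷ [] → ⊥
        -- The switch exchanges the colors of `j` and `w`, starting at `j`. If it ends off the outer
        -- arc, `w` keeps its color and `j` acquires it, against `separated`. If it ends on that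
        -- arc, `i` and `k` are unchanged and `third` forces `j` to keep its color.
        single {j} refl with kempe (φ j ▹ φ w) j sφ (▹-fresh _ _ (separated refl sφ))
        ... | y , φ′ , fl , sφ′ with trans (source fl) (▹-swap (φ j) (φ w)) | y ∈? (w ∷ w′ ∷ O)
        ... | e | no y∉ = separated refl sφ′ (trans e (sym (fixed fl
          (λ where refl → V#k∷O (here refl) (there (here refl))) (λ where refl → y∉ (here refl)))))
        ... | e | yes y∈ = separated refl sφ (suc-injective (trans (third refl sφ) (trans
          (sym (cong₂ (λ a b → suc a ⊕ suc b)
            (fixed fl (λ where refl → i∉V (here refl)) (λ where refl → i∉k∷O (there y∈)))
            (fixed fl (λ where refl → k∉i∷V (there (here refl))) (λ where refl → k∉O y∈))))
          (trans (sym (third refl sφ′)) (cong suc e)))))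

        by-length : ∀ L → V ≡ L → ¬ Mono φ V
        by-length []          refl (_ , _ , ())
        by-length (_ ∷ [])    eq   _ = single eq
        by-length (_ ∷ _ ∷ _) eq   μ = long-arc eq sφ μ

    -- One of the arcs has at least two semiedges; after a rotation it is the outer one.
    differ⇒empty : ∀ {i V k O} → Arcs i V k O → Differ i k → 3 ≤ length V + length O → ∀ {φ} → ¬ S φ
    differ⇒empty {V = _}         {O = _ ∷ _ ∷ _} ar differ _ = CherryLongArc.impossible ar differ
    differ⇒empty {V = _ ∷ _ ∷ _} {O = []}        ar differ _ = CherryLongArc.impossible (arcs-rotate ar) (λ sφ e → differ sφ (sym e))
    differ⇒empty {V = _ ∷ _ ∷ _} {O = _ ∷ []}    ar differ _ = CherryLongArc.impossible (arcs-rotate ar) (λ sφ e → differ sφ (sym e))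
    differ⇒empty {V = []}        {O = []}        _ _ ()
    differ⇒empty {V = []}        {O = _ ∷ []}    _ _ (s≤s ())
    differ⇒empty {V = _ ∷ []}    {O = []}        _ _ (s≤s ())
    differ⇒empty {V = _ ∷ []}    {O = _ ∷ []}    _ _ (s≤s (s≤s ()))

    -- Semiedges with always equal colors

    module Free {i V k O} (ar : Arcs i V k O) (same : Same i k) where
      open ArcFacts ar

      -- The colors at `i` and `k` stay equal, so a chain starting at `i` must end at `k`; the
      -- switch is chosen to turn the color of `i` into `c`.
      recolor : ∀ {φ} → S φ → ∀ c → ∃[ φ′ ] S φ′ × φ′ i ≡ c × φ′ k ≡ c × Agree φ φ′ V × Agree φ φ′ O
      recolor {φ} sφ c with φ i ≟ c
      ... | yes refl = φ , sφ , refl , sym (same sφ) , (λ _ → refl) , (λ _ → refl)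
      ... | no i≢c with kempe (φ i ▹ c) i sφ (▹-fresh _ _ i≢c)
      ... | y , φ′ , fl , sφ′ with trans (source fl) (▹-swap (φ i) c) | k ≟ y
      ... | e | yes refl = φ′ , sφ′ , e , trans (sym (same sφ′)) e , agreeV fl , agreeO fl
      ... | e | no k≢y = contradiction (trans (same sφ) (trans (sym (fixed fl (λ where refl → i∉k∷O (here refl)) k≢y))
                                          (trans (sym (same sφ′)) e))) i≢c

      -- The walk of the state recolored by `c`, written with the colors of `φ` on the arcs. The two
      -- copies of `c` cancel, so the outer walk starts at `base ⊕ sum φ V`.
      record Recolored (φ : Fin m → Color) (c : Color) : Set where
        field
          {base}  : Klein
          start   : base ≢ zero
          inner   : Walk φ (base ⊕ suc c) V (base ⊕ suc c ⊕ sum φ V)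
          mid     : base ⊕ suc c ⊕ sum φ V ≢ zero
          outer   : Walk φ (base ⊕ sum φ V) O base

      recolored : ∀ {φ} → S φ → ∀ c → Recolored φ c
      recolored {φ} sφ c with recolor sφ c
      ... | φ′ , sφ′ , ei , ek , aV , aO with steps sφ′
      ... | f , st with Steps.start st | walk-agree aV (Steps.inner st) | Steps.mid st | walk-agree aO (Steps.outer st)
      ... | p | u | q | v rewrite ei | ek | sum-agree V aV | ⊕-conjugate f (suc c) (sum φ V) =
        record { start = p ; inner = u ; mid = q ; outer = v }

      balanced : ∀ {φ} → S φ → sum φ V ≡ zero
      balanced {φ} sφ = go (sum φ V) refl
        where
        go : ∀ t → sum φ V ≡ t → t ≡ zero
        go zero    _ = refl
        -- With a color other than `t` at `i` and `k`, the partial sums around `V` form the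
        -- forbidden square of `no-square`.
        go (suc t) e with recolored sφ (another t)
        ... | r = ⊥-elim (no-square (Recolored.base r) (another t) t (another-≢ t ∘ sym) (Recolored.start r)
          (walk-start (Recolored.inner r))
          (subst (λ x → Recolored.base r ⊕ suc (another t) ⊕ x ≢ zero) e (Recolored.mid r))
          (subst (λ x → Recolored.base r ⊕ x ≢ zero) e (walk-start (Recolored.outer r))))

      -- By `spread`, two of the three recolorings enter `V` at different partial sums, and
      -- `walk-mono` applies.
      constant : ∀ {φ} → S φ → ∃[ δ ] All (λ j → suc (φ j) ≡ δ) V
      constant sφ with spread (λ c → Recolored.base (recolored sφ c)) (λ c → Recolored.start (recolored sφ c))
                              (λ c → walk-start (Recolored.inner (recolored sφ c)))
      ... | c , c′ , δ≢0 = _ , walk-mono (Recolored.inner (recolored sφ c)) (Recolored.inner (recolored sφ c′)) δ≢0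

      -- Since `V` is balanced, the outer walk starts at `base` itself; equal colors at `j` and `w`
      -- would again give a square.
      contrast : ∀ {φ j w V′ O′} → S φ → V ≡ j ∷ V′ → O ≡ w ∷ O′ → φ j ≢ φ w
      contrast {φ} {j} {w} sφ refl refl e with recolored sφ (another (φ j))
      ... | r with Recolored.inner r | Recolored.outer r
      ... | p ∷ u | q ∷ v = no-square (Recolored.base r) (another (φ j)) (φ j) (another-≢ (φ j) ∘ sym)
        (Recolored.start r) p (walk-start u)
        (subst (λ c → Recolored.base r ⊕ suc c ≢ zero) (sym e)
          (subst (λ x → x ⊕ suc (φ w) ≢ zero)
            (trans (cong (Recolored.base r ⊕_) (balanced sφ)) (⊕-identityʳ _)) (walk-start v)))

      -- V remains constant, so the switch must also change z and everything after it.
      next-flipped : ∀ {φ j z W} → V ≡ j ∷ z ∷ W → S φ → ∀ d → φ j ≢ d →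
        ∃[ φ′ ] Flip d j z φ φ′ × S φ′ × (∀ x → x ∈ W → φ′ x ≢ φ x)
      next-flipped {φ} {j} {z} {W} refl sφ d j≢d with kempe d j sφ j≢d
      ... | y , φ′ , fl , sφ′ = conclude (y ≟ z)
        where
        changed : ∀ {x δ δ′} → All (λ j → suc (φ j) ≡ δ) (j ∷ z ∷ W) → All (λ j → suc (φ′ j) ≡ δ′) (j ∷ z ∷ W) →
                  x ∈ z ∷ W → φ′ x ≢ φ x
        changed (pj ∷ ps) (pj′ ∷ ps′) x∈ e = proj₁ (▹-moves (φ j) d j≢d)
          (trans (sym (source fl)) (suc-injective (trans pj′ (trans (sym (All.lookup ps′ x∈))
            (trans (cong suc e) (trans (All.lookup ps x∈) (sym pj)))))))
        changed′ : ∀ {x} → x ∈ z ∷ W → φ′ x ≢ φ x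
        changed′ = changed (proj₂ (constant sφ)) (proj₂ (constant sφ′))
        z≢j : z ≢ j
        z≢j refl with uniqueV
        ... | (j≢z ∷ _) ∷ _ = j≢z refl
        conclude : Dec (y ≡ z) → _
        conclude (yes refl) = φ′ , fl , sφ′ , λ _ x∈ → changed′ (there x∈)
        conclude (no y≢z)   = contradiction (fixed fl z≢j (λ e → y≢z (sym e))) (changed′ (here refl))

      -- Chains from `j` can be taken to end at `z`. If `O` starts with `w`, giving `j` the color of
      -- `w` contradicts `contrast`. If `O` is empty, `V` has a third semiedge, which would have to
      -- change but is fixed.
      impossible : ∀ {j z W} → V ≡ j ∷ z ∷ W → 3 ≤ length V + length O → ∀ {φ} → ¬ S φ
      impossible {j} {z} {W} V≡ len {φ} sφ = by-outer O refl W V≡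
        where
        by-outer : ∀ L → O ≡ L → ∀ W → V ≡ j ∷ z ∷ W → ⊥
        by-outer (w ∷ L) refl W refl with next-flipped refl sφ (φ j ▹ φ w) (▹-fresh _ _ (contrast sφ refl refl))
        ... | φ′ , fl , sφ′ , _ = contrast sφ′ refl refl (trans (source fl) (trans (▹-swap (φ j) (φ w))
          (sym (fixed fl (λ where refl → V#k∷O (here refl) (there (here refl)))
                         (λ where refl → V#k∷O (there (here refl)) (there (here refl)))))))
        by-outer [] refl []       refl = contradiction len λ { (s≤s (s≤s ())) }
        by-outer [] refl (x ∷ W′) refl with next-flipped refl sφ (another (φ j)) (another-≢ (φ j))
        ... | φ′ , fl , sφ′ , changed = changed x (here refl) (fixed fl x≢j x≢z)
          where
          x≢j : x ≢ j
          x≢j refl with uniqueV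
          ... | (_ ∷ j≢x ∷ _) ∷ _ = j≢x refl
          x≢z : x ≢ z
          x≢z refl with uniqueV
          ... | _ ∷ (z≢x ∷ _) ∷ _ = z≢x refl

    same⇒empty : ∀ {i V k O} → Arcs i V k O → Same i k → 3 ≤ length V + length O → ∀ {φ} → ¬ S φ
    same⇒empty {V = _ ∷ _ ∷ _} ar same len = Free.impossible ar same refl len
    same⇒empty {V = V} {O = O@(_ ∷ _ ∷ _)} ar same len =
      Free.impossible (arcs-rotate ar) (λ sφ → sym (same sφ)) refl (subst (3 ≤_) (+-comm (length V) (length O)) len)
    same⇒empty {V = []}        {O = []}        _ _ ()
    same⇒empty {V = []}        {O = _ ∷ []}    _ _ (s≤s ())
    same⇒empty {V = _ ∷ []}    {O = []}        _ _ (s≤s ())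
    same⇒empty {V = _ ∷ []}    {O = _ ∷ []}    _ _ (s≤s (s≤s ()))

-- Kempe chains in a multipole

injective⇒onto : ∀ {n} {f : Fin n → Fin n} → Injective _≡_ _≡_ f → ∀ y → ∃[ x ] f x ≡ y
injective⇒onto {suc n} {f} inj y with any? (λ x → f x ≟ y)
... | yes found = found
... | no missed = contradiction (injective⇒≤ {f = λ x → punchOut (y≢ x)}
        (λ {x} {x′} e → inj (punchOut-injective (y≢ x) (y≢ x′) e))) (<-irrefl refl)
  where
  y≢ : ∀ x → y ≢ f x
  y≢ x e = missed (x , sym e)

▹-injective : ∀ d {a b} → a ▹ d ≡ b ▹ d → a ≡ b
▹-injective d {a} {b} e = trans (sym (▹-involutive a d)) (trans (cong (_▹ d) e) (▹-involutive b d))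

module Kempe {m : ℕ} (N : Multipole m) (φ : TaitColoring N) (d : Color) where

  Item : Set
  Item = Fin (size N) ⊎ Fin m

  _≟ᵢ_ : (s t : Item) → Dec (s ≡ t)
  _≟ᵢ_ = ≡-dec _≟_ _≟_

  item : ∀ {u} → End N u → Item
  item (fst e _)  = inj₁ e
  item (snd e _)  = inj₁ e
  item (semi i _) = inj₂ i

  color : Item → Color
  color = [ edgeColor φ , semiColor φ ]

  endColor-item : ∀ (c : Item → Color) {u} (ε : End N u) → endColor N (c ∘ inj₁) (c ∘ inj₂) ε ≡ c (item ε)
  endColor-item c (fst e _)  = refl
  endColor-item c (snd e _)  = refl
  endColor-item c (semi i _) = refl

  color-injective : ∀ {u} {ε ε′ : End N u} → color (item ε) ≡ color (item ε′) → ε ≡ ε′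
  color-injective {u} {ε} {ε′} e = proper φ u (trans (endColor-item color ε) (trans e (sym (endColor-item color ε′))))

  end-of-color : ∀ u c → ∃[ ε ] color (item {u} ε) ≡ c
  end-of-color u c with injective⇒onto {f = color ∘ item ∘ Inverse.to (cubic N u)}
                          (λ e → Injection.injective (Inverse⇒Injection (cubic N u)) (color-injective e)) c
  ... | x , e = Inverse.to (cubic N u) x , e

  Moves : ∀ {u} → End N u → Set
  Moves ε = color (item ε) ≢ d

  -- `P` is a set of items to be switched. The coloring stays proper at `u` when the two ends not
  -- colored `d` are both in `P` or both outside.
  Balanced : (Item → Bool) → Fin (order N) → Set
  Balanced P u = ∀ (ε ε′ : End N u) → Moves ε → Moves ε′ → P (item ε) ≡ P (item ε′)

  module Switch (P : Item → Bool) (balanced : ∀ u → Balanced P u)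
                (free-balanced : ∀ i j → attach N i ≡ inj₂ j → P (inj₂ i) ≡ P (inj₂ j)) where

    flipped : Bool → Color → Color
    flipped b c = if b then c ▹ d else c

    flipped-d : ∀ b b′ → flipped b d ≡ flipped b′ d
    flipped-d false false = refl
    flipped-d false true  = sym (▹-idem d)
    flipped-d true  false = ▹-idem d
    flipped-d true  true  = refl

    flipped-injective : ∀ b {a c} → flipped b a ≡ flipped b c → a ≡ c
    flipped-injective false e = e
    flipped-injective true  e = ▹-injective d e

    newColor : Item → Color
    newColor t = flipped (P t) (color t)

    -- Switching does not affect color `d`, so membership of the end colored `d` is irrelevant, and
    -- a single permutation of the colors acts at `u`. The bit is read off at an end of another
    -- color.
    uniform : ∀ u → ∃[ b ] (∀ (ε : End N u) → newColor (item ε) ≡ flipped b (color (item ε)))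
    uniform u with end-of-color u (another d)
    ... | ε₀ , e₀ = P (item ε₀) , λ ε → case color (item ε) ≟ d of λ where
      (yes ≡d) → trans (cong (flipped (P (item ε))) ≡d) (trans (flipped-d (P (item ε)) (P (item ε₀)))
                   (cong (flipped (P (item ε₀))) (sym ≡d)))
      (no ≢d)  → cong (λ b → flipped b (color (item ε)))
                   (balanced u ε ε₀ ≢d (λ e → another-≢ d (trans (sym e) e₀)))

    switched : TaitColoring N
    switched = record
      { edgeColor = newColor ∘ inj₁
      ; semiColor = newColor ∘ inj₂
      ; proper    = λ u {ε} {ε′} e → let b , eq = uniform u in
          color-injective (flipped-injective b (trans (sym (eq ε)) (trans (trans (sym (endColor-item newColor ε))
            (trans e (endColor-item newColor ε′))) (eq ε′))))
      ; free      = λ i j e → cong₂ flipped (free-balanced i j e) (free φ i j e)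
      }

  insert : Item → (Item → Bool) → Item → Bool
  insert t P s = if does (s ≟ᵢ t) then true else P s

  insert-≡ : ∀ t P → insert t P t ≡ true
  insert-≡ t P with t ≟ᵢ t
  ... | yes _  = refl
  ... | no t≢t = contradiction refl t≢t

  insert-≢ : ∀ {t s} P → s ≢ t → insert t P s ≡ P s
  insert-≢ {t} {s} P s≢t with s ≟ᵢ t
  ... | yes s≡t = contradiction s≡t s≢t
  ... | no _    = refl

  insert-⊎ : ∀ {t s} P → insert t P s ≡ true → s ≡ t ⊎ P s ≡ true
  insert-⊎ {t} {s} P e with s ≟ᵢ t
  ... | yes s≡t = inj₁ s≡t
  ... | no _    = inj₂ e

  Result : Fin m → Set
  Result i = ∃[ y ] ∃[ φ′ ] Flip d i y (semiColor φ) (semiColor {M = N} φ′)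

  -- P is the set of items visited so far, starting at i; switching the colors of P
  -- keeps the coloring proper except at w, where the chain is to be continued.
  record Trail (i : Fin m) (P : Item → Bool) (w : Fin (order N)) : Set where
    field
      from       : ∃[ v ] attach N i ≡ inj₁ v
      begins     : P (inj₂ i) ≡ true
      only       : ∀ j → P (inj₂ j) ≡ true → j ≡ i
      elsewhere  : ∀ u → u ≢ w → Balanced P u
      {tip next} : End N w
      tip-moves  : Moves tip
      next-moves : Moves next
      tip∈       : P (item tip) ≡ true
      next∉      : P (item next) ≡ false

    tip≢next : color (item tip) ≢ color (item next)
    tip≢next e with trans (sym tip∈) (trans (cong (P ∘ item) (color-injective {ε = tip} {ε′ = next} e)) next∉)
    ... | ()

    two : ∀ (ε : End N w) → Moves ε → ε ≡ tip ⊎ ε ≡ next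
    two ε ε-moves with color (item ε) ≟ color (item tip)
    ... | yes e = inj₁ (color-injective e)
    ... | no ≢  = inj₂ (color-injective (trans (▹-only-two _ _ d tip-moves ε-moves (≢ ∘ sym))
                    (sym (▹-only-two _ _ d tip-moves next-moves tip≢next))))

    balanced-at-w : ∀ P′ → P′ (item tip) ≡ true → P′ (item next) ≡ true → Balanced P′ w
    balanced-at-w P′ p q ε ε′ a b = trans (true-on ε a) (sym (true-on ε′ b))
      where
      true-on : ∀ ε → Moves ε → P′ (item ε) ≡ true
      true-on ε a with two ε a
      ... | inj₁ refl = p
      ... | inj₂ refl = q

  partner : ∀ {u} (ε : End N u) → Moves ε → ∃[ ε′ ] Moves {u} ε′ × color (item ε′) ≢ color (item ε)
  partner {u} ε moves with end-of-color u (color (item ε) ▹ d) | ▹-moves (color (item ε)) d moves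
  ... | ε′ , e | ≢ε , ≢d = ε′ , (λ e′ → ≢d (trans (sym e) e′)) , (λ e′ → ≢ε (trans (sym e) e′))

  flip-of : ∀ {i y} → y ≢ i → semiColor φ i ≢ d → semiColor φ y ≢ d → (P : Item → Bool) →
            P (inj₂ i) ≡ true → P (inj₂ y) ≡ true → (∀ j → P (inj₂ j) ≡ true → j ≡ i ⊎ j ≡ y) →
            (∀ u → Balanced P u) → (∀ a b → attach N a ≡ inj₂ b → P (inj₂ a) ≡ P (inj₂ b)) → Result i
  flip-of {i} {y} y≢i mi my P pi py only bal free = y , Switch.switched P bal free , record
    { distinct = y≢i
    ; movable  = my
    ; source   = cong (λ b → if b then semiColor φ i ▹ d else semiColor φ i) pi
    ; target   = cong (λ b → if b then semiColor φ y ▹ d else semiColor φ y) py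
    ; fixed    = unflipped
    }
    where
    unflipped : ∀ {z} → z ≢ i → z ≢ y → (if P (inj₂ z) then semiColor φ z ▹ d else semiColor φ z) ≡ semiColor φ z
    unflipped {z} z≢i z≢y with P (inj₂ z) in e
    ... | false = refl
    ... | true with only z e
    ... | inj₁ z≡i = contradiction z≡i z≢i
    ... | inj₂ z≡y = contradiction z≡y z≢y

  -- The ends of a loop would be two ends of the same color at one vertex, so the coloring makes `v`
  -- differ from `u`.
  other-end : ∀ {u} (ε : End N u) {e} → item ε ≡ inj₁ e →
    ∃[ v ] ∃[ η ] item {v} η ≡ inj₁ e × v ≢ u × (∀ {x} (ξ : End N x) → item ξ ≡ inj₁ e → x ≡ u ⊎ x ≡ v)
  other-end (fst e p) refl = proj₂ (edge N e) , snd e refl , refl , loopless p , λ where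
      (fst _ q) refl → inj₁ (trans (sym q) p)
      (snd _ q) refl → inj₂ (sym q)
    where
    loopless : ∀ {u} → proj₁ (edge N e) ≡ u → proj₂ (edge N e) ≢ u
    loopless p q with color-injective {ε = fst e p} {ε′ = snd e q} refl
    ... | ()
  other-end (snd e p) refl = proj₁ (edge N e) , fst e refl , refl , loopless p , λ where
      (snd _ q) refl → inj₁ (trans (sym q) p)
      (fst _ q) refl → inj₂ (sym q)
    where
    loopless : ∀ {u} → proj₂ (edge N e) ≡ u → proj₁ (edge N e) ≢ u
    loopless p q with color-injective {ε = snd e p} {ε′ = fst e q} refl
    ... | ()

  balanced-insert : ∀ P t {u} → (∀ (ε : End N u) → item ε ≢ t) → Balanced P u → Balanced (insert t P) u
  balanced-insert P t avoid bal ε ε′ a b =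
    trans (insert-≢ P (avoid ε)) (trans (bal ε ε′ a b) (sym (insert-≢ P (avoid ε′))))

  -- The set `q` contains all unvisited edges and loses each edge traversed, so its size bounds the
  -- chain.
  follow : ∀ {i} → semiColor φ i ≢ d → ∀ (q : Subset (size N)) → Acc _<_ (card q) → ∀ {P w} → Trail i P w →
           (∀ e → P (inj₁ e) ≡ false → e ∈ₛ q) → Result i
  follow {i} mi q (acc rec) {P} {w} tr unvisited = go (item (Trail.next tr)) refl
    where
    open Trail tr
    go : ∀ t → item next ≡ t → Result i
    go (inj₂ y) e = flip-of y≢i mi (λ c → next-moves (trans (cong color e) c)) P′
        (trans (insert-≢ P (λ i≡y → y≢i (sym (inj₂-injective i≡y)))) begins) (insert-≡ (inj₂ y) P)
        (λ j p → [ (λ j≡y → inj₂ (inj₂-injective j≡y)) , (λ p′ → inj₁ (only j p′)) ] (insert-⊎ {inj₂ y} P p))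
        balanced (λ a b e′ → trans (unvisited-free a b e′) (sym (unvisited-free b a (proj₂ (paired N a b e′)))))
      where
      P′ = insert (inj₂ y) P
      y≢i : y ≢ i
      y≢i refl with trans (sym begins) (trans (cong P (sym e)) next∉)
      ... | ()
      y-at : ∀ {u} (ε : End N u) → item ε ≡ inj₂ y → attach N y ≡ inj₁ u
      y-at (semi _ p) refl = p
      w-at : attach N y ≡ inj₁ w
      w-at = y-at next e
      balanced : ∀ u → Balanced P′ u
      balanced u with u ≟ w
      ... | yes refl = balanced-at-w P′ (trans (insert-≢ P (λ e′ → tip≢next (cong color (trans e′ (sym e))))) tip∈)
                         (trans (cong P′ e) (insert-≡ (inj₂ y) P))
      ... | no u≢w   = balanced-insert P (inj₂ y) (λ ε e′ → u≢w (inj₁-injective (trans (sym (y-at ε e′)) w-at))) (elsewhere u u≢w)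
      -- The only semiedges in `P′` are `i` and `y`, both incident to vertices.
      unvisited-free : ∀ a b → attach N a ≡ inj₂ b → P′ (inj₂ a) ≡ false
      unvisited-free a b e′ with P′ (inj₂ a) in p
      ... | false = refl
      ... | true with insert-⊎ {inj₂ y} P p
      ... | inj₁ refl with trans (sym e′) w-at
      ... | ()
      unvisited-free a b e′ | true | inj₂ p′ with only a p′
      ... | refl with trans (sym e′) (proj₂ from)
      ... | ()
    go (inj₁ f) e with other-end next e
    ... | v , η , η≡ , v≢w , ends with partner η (λ c → next-moves (trans (cong color (trans e (sym η≡))) c))
    ... | η′ , η′-moves , η′≢η = follow mi (q - f) (rec (x∈p⇒∣p-x∣<∣p∣ f∈q)) trail′ unvisited′
      where
      P′ = insert (inj₁ f) P
      f∉ : P (inj₁ f) ≡ false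
      f∉ = trans (cong P (sym e)) next∉
      f∈q : f ∈ₛ q
      f∈q = unvisited f f∉
      η-moves : Moves η
      η-moves c = next-moves (trans (cong color (trans e (sym η≡))) c)
      η′≢f : item η′ ≢ inj₁ f
      η′≢f e′ = η′≢η (cong color (trans e′ (sym η≡)))
      elsewhere′ : ∀ u → u ≢ v → Balanced P′ u
      elsewhere′ u u≢v with u ≟ w
      ... | yes refl = balanced-at-w P′ (trans (insert-≢ P (λ e′ → tip≢next (cong color (trans e′ (sym e))))) tip∈)
                         (trans (cong P′ e) (insert-≡ (inj₁ f) P))
      ... | no u≢w = balanced-insert P (inj₁ f) (λ ε e′ → [ u≢w , u≢v ] (ends ε e′)) (elsewhere u u≢w)
      trail′ : Trail i P′ v
      trail′ = record
        { from = from
        ; begins = begins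
        ; only = only
        ; elsewhere = elsewhere′
        ; tip = η ; next = η′
        ; tip-moves = η-moves
        ; next-moves = η′-moves
        ; tip∈ = trans (cong P′ η≡) (insert-≡ (inj₁ f) P)
        -- As `v ≢ w`, `P` is balanced at `v`; the edge `f` was not in `P`, so neither is its
        -- continuation, and the chain cannot run into itself.
        ; next∉ = trans (insert-≢ P η′≢f) (trans (elsewhere v v≢w η′ η η′-moves η-moves) (trans (cong P η≡) f∉))
        }
      unvisited′ : ∀ e → P′ (inj₁ e) ≡ false → e ∈ₛ q - f
      unvisited′ x p = x∈p∧x≢y⇒x∈p-y (unvisited x (trans (sym (insert-≢ P (x≢f ∘ inj₁-injective))) p)) x≢f
        where
        x≢f : x ≢ f
        x≢f refl with trans (sym p) (insert-≡ (inj₁ f) P)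
        ... | ()

  none : Item → Bool
  none _ = false

  kempe : ∀ i → semiColor φ i ≢ d → Result i
  kempe i mi with attach N i in at
  ... | inj₁ w = follow mi ⊤ (<-wellFounded _) trail (λ _ _ → ∈⊤)
    where
    P = insert (inj₂ i) none
    i-only : ∀ {u} (ε : End N u) → item ε ≡ inj₂ i → attach N i ≡ inj₁ u
    i-only (semi _ p) refl = p
    i-alone : ∀ j → P (inj₂ j) ≡ true → j ≡ i
    i-alone j p with insert-⊎ {inj₂ i} none p
    ... | inj₁ e = inj₂-injective e
    trail : Trail i P w
    trail with partner (semi {x = w} i at) mi
    ... | ε , moves , ≢ = record
      { from = w , at
      ; begins = insert-≡ (inj₂ i) none
      ; only = i-alone
      ; elsewhere = λ u u≢w → balanced-insert none (inj₂ i)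
          (λ ε e → u≢w (inj₁-injective (trans (sym (i-only ε e)) at))) (λ _ _ _ _ → refl)
      ; tip = semi i at ; next = ε
      ; tip-moves = mi ; next-moves = moves
      ; tip∈ = insert-≡ (inj₂ i) none
      ; next∉ = insert-≢ {inj₂ i} {item ε} none (λ e → ≢ (cong color e))
      }
  -- The two semiedges of a free edge form a complete chain.
  ... | inj₂ j = flip-of (i≢j ∘ sym) mi (λ c → mi (trans (free φ i j at) c)) P
      (P-true (inj₂ refl)) (P-true (inj₁ refl)) (λ k p → P-only k p)
      (λ u → balanced-insert (insert (inj₂ i) none) (inj₂ j) (avoids j (proj₂ (paired N i j at)))
        (balanced-insert none (inj₂ i) (avoids i at) (λ _ _ _ _ → refl)))
      free-balanced
    where
    i≢j = proj₁ (paired N i j at)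
    P = insert (inj₂ j) (insert (inj₂ i) none)
    P-only : ∀ k → P (inj₂ k) ≡ true → k ≡ i ⊎ k ≡ j
    P-only k p with insert-⊎ {inj₂ j} (insert (inj₂ i) none) p
    ... | inj₁ e = inj₂ (inj₂-injective e)
    ... | inj₂ p′ with insert-⊎ {inj₂ i} none p′
    ... | inj₁ e = inj₁ (inj₂-injective e)
    P-true : ∀ {k} → k ≡ j ⊎ k ≡ i → P (inj₂ k) ≡ true
    P-true (inj₁ refl) = insert-≡ (inj₂ j) (insert (inj₂ i) none)
    P-true (inj₂ refl) = trans (insert-≢ (insert (inj₂ i) none) (i≢j ∘ inj₂-injective)) (insert-≡ (inj₂ i) none)
    avoids : ∀ a {b u} → attach N a ≡ inj₂ b → (ε : End N u) → item ε ≢ inj₂ a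
    avoids a e (semi _ p) refl with trans (sym e) p
    ... | ()
    P-cong : ∀ a b → attach N a ≡ inj₂ b → P (inj₂ a) ≡ true → P (inj₂ b) ≡ true
    P-cong a b e p with P-only a p
    ... | inj₁ refl = P-true (inj₁ (inj₂-injective (trans (sym e) at)))
    ... | inj₂ refl = P-true (inj₂ (inj₂-injective (trans (sym e) (proj₂ (paired N i j at)))))
    free-balanced : ∀ a b → attach N a ≡ inj₂ b → P (inj₂ a) ≡ P (inj₂ b)
    free-balanced a b e with P (inj₂ a) in p | P (inj₂ b) in p′
    ... | true  | true  = refl
    ... | false | false = refl
    ... | true  | false = trans (sym (P-cong a b e p)) p′
    ... | false | true  = trans (sym p) (P-cong b a (proj₂ (paired N a b e)) p′)

-- The cycle

abstract
  ▹-fresh₃ : ∀ a b c → a ≢ b → a ≢ c → b ≢ c → suc c ≡ suc a ⊕ suc b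
  ▹-fresh₃ = from-yes (all? λ a → all? λ b → all? λ c →
    ¬? (a ≟ b) →-dec ¬? (a ≟ c) →-dec ¬? (b ≟ c) →-dec suc c ≟ suc a ⊕ suc b)

module Cycle (n : ℕ) where

  m : ℕ
  m = suc n

  prev : Fin m → Fin m
  prev zero    = fromℕ n
  prev (suc j) = inject₁ j

  prev-injective : ∀ {x y} → prev x ≡ prev y → x ≡ y
  prev-injective {zero}  {zero}  _ = refl
  prev-injective {zero}  {suc y} e = contradiction e fromℕ≢inject₁
  prev-injective {suc x} {zero}  e = contradiction (sym e) fromℕ≢inject₁
  prev-injective {suc x} {suc y} e = cong suc (inject₁-injective e)

  next : Fin m → Fin m
  next x = proj₁ (injective⇒onto prev-injective x)

  prev-next : ∀ x → prev (next x) ≡ x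
  prev-next x = proj₂ (injective⇒onto prev-injective x)

  next-prev : ∀ x → next (prev x) ≡ x
  next-prev x = prev-injective (prev-next (prev x))

  edges : Fin m → Fin m × Fin m
  edges e = e , next e

  CycleEnd : Fin m → Set
  CycleEnd = EndAt edges inj₁

  snd-unique : ∀ {x e e′} (p : next e ≡ x) (q : next e′ ≡ x) → _≡_ {A = CycleEnd x} (snd e p) (snd e′ q)
  snd-unique {x} {e} {e′} p q with trans (sym (prev-next e)) (trans (cong prev (trans p (sym q))) (prev-next e′))
  snd-unique refl refl | refl = refl

  ends : ∀ x → Fin 3 ↔ CycleEnd x
  ends x = mk↔ₛ′ to from to∘from from∘to
    where
    to : Fin 3 → CycleEnd x
    to zero             = fst x refl
    to (suc zero)       = snd (prev x) (next-prev x)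
    to (suc (suc zero)) = semi x refl
    from : CycleEnd x → Fin 3
    from (fst _ _)  = zero
    from (snd _ _)  = suc zero
    from (semi _ _) = suc (suc zero)
    to∘from : ∀ ε → to (from ε) ≡ ε
    to∘from (fst _ refl)  = refl
    to∘from (snd _ p)     = snd-unique (next-prev x) p
    to∘from (semi _ refl) = refl
    from∘to : ∀ c → from (to c) ≡ c
    from∘to zero             = refl
    from∘to (suc zero)       = refl
    from∘to (suc (suc zero)) = refl

  cycle : Multipole m
  cycle = record
    { order = m ; size = m ; edge = edges ; attach = inj₁
    ; paired = λ _ _ () ; cubic = ends }

  -- Vertex `x` lies on the edges `prev x` and `x`; its semiedge receives the third color.
  fromEdges : (c : Fin m → Color) → (∀ x → c (prev x) ≢ c x) → TaitColoring cycle
  fromEdges c step = record { edgeColor = c ; semiColor = s ; proper = λ _ → inj ; free = λ _ _ () }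
    where
    s : Fin m → Color
    s x = c (prev x) ▹ c x
    fst≢snd : ∀ e → c (next e) ≢ c e
    fst≢snd e p = step (next e) (trans (cong c (prev-next e)) (sym p))
    s≢fst : ∀ x → s x ≢ c x
    s≢fst x = proj₂ (▹-moves (c (prev x)) (c x) (step x))
    s≢snd : ∀ e → s (next e) ≢ c e
    s≢snd e p = proj₁ (▹-moves (c (prev (next e))) (c (next e)) (step (next e))) (trans p (cong c (sym (prev-next e))))
    inj : ∀ {x} {ε ε′ : CycleEnd x} → endColor cycle c s ε ≡ endColor cycle c s ε′ → ε ≡ ε′
    inj {ε = fst _ refl}  {fst _ refl}  _ = refl
    inj {ε = fst _ refl}  {snd e refl}  p = contradiction p (fst≢snd e)
    inj {ε = fst x refl}  {semi _ refl} p = contradiction (sym p) (s≢fst x)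
    inj {ε = snd e refl}  {fst _ refl}  p = contradiction (sym p) (fst≢snd e)
    inj {ε = snd _ p}     {snd _ q}     _ = snd-unique p q
    inj {ε = snd e refl}  {semi _ refl} p = contradiction (sym p) (s≢snd e)
    inj {ε = semi x refl} {fst _ refl}  p = contradiction p (s≢fst x)
    inj {ε = semi _ refl} {snd e refl}  p = contradiction p (s≢snd e)
    inj {ε = semi _ refl} {semi _ refl} _ = refl

  -- The edge colors are the partial sums: three distinct colors add up to zero, so edge `x` is edge
  -- `prev x` plus the semiedge at `x`.
  state-walk : (φ : TaitColoring cycle) → Closed (semiColor φ) (allFin m)
  state-walk φ = e (fromℕ n) , walk {f = E} (λ { zero () ; (suc _) () }) step
    where
    e : Fin m → Klein
    e x = suc (edgeColor φ x)
    -- The index is shifted by one: the value at `zero` is the last edge, which enters vertex `zero`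
    -- and closes the walk.
    E : Fin (suc m) → Klein
    E zero    = e (fromℕ n)
    E (suc x) = e x
    E-inject₁ : ∀ x → E (inject₁ x) ≡ e (prev x)
    E-inject₁ zero    = refl
    E-inject₁ (suc x) = refl
    distinct : ∀ {x} {ε ε′ : CycleEnd x} → ε ≢ ε′ →
               endColor cycle (edgeColor φ) (semiColor φ) ε ≢ endColor cycle (edgeColor φ) (semiColor φ) ε′
    distinct ≢ε c = ≢ε (proper φ _ c)
    step : ∀ x → E (suc x) ≡ E (inject₁ x) ⊕ suc (semiColor φ x)
    step x = trans (▹-fresh₃ (edgeColor φ (prev x)) (semiColor φ x) (edgeColor φ x)
        (distinct {ε = snd (prev x) (next-prev x)} {semi x refl} λ ())
        (distinct {ε = snd (prev x) (next-prev x)} {fst x refl} λ ())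
        (distinct {ε = semi x refl} {fst x refl} λ ()))
      (cong (_⊕ suc (semiColor φ x)) (sym (E-inject₁ x)))
    walk : ∀ {k} {g : Fin k → Fin m} {f : Fin (suc k) → Klein} → (∀ x → f x ≢ zero) →
           (∀ x → f (suc x) ≡ f (inject₁ x) ⊕ suc (semiColor φ (g x))) →
           Walk (semiColor φ) (f zero) (tabulate g) (f (fromℕ k))
    walk {zero}  f≢0 _ = [] (f≢0 zero)
    walk {suc k} {g} {f} f≢0 st = f≢0 zero ∷ subst (λ y → Walk _ y (tabulate (g ∘ suc)) (f (fromℕ (suc k)))) (st zero)
      (walk {f = f ∘ suc} (f≢0 ∘ suc) (st ∘ suc))

-- A coloring of the cycle

alternating : ℕ → Color
alternating zero          = zero
alternating (suc zero)    = suc zero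
alternating (suc (suc k)) = alternating k

alternating-≢ : ∀ k → alternating k ≢ alternating (suc k)
alternating-≢ zero          ()
alternating-≢ (suc zero)    ()
alternating-≢ (suc (suc k)) = alternating-≢ k

alternating-≢2 : ∀ k → alternating k ≢ suc (suc zero)
alternating-≢2 zero          ()
alternating-≢2 (suc zero)    ()
alternating-≢2 (suc (suc k)) = alternating-≢2 k

-- Edge `zero` takes the third color, so the alternation on the remaining edges closes up for either
-- parity of the length.
cycle-colorable : ∀ n → TaitColoring (Cycle.cycle (suc n))
cycle-colorable n = Cycle.fromEdges (suc n) c step
  where
  c : Fin (suc (suc n)) → Color
  c zero    = suc (suc zero)
  c (suc x) = alternating (toℕ x)
  step : ∀ x → c (Cycle.prev (suc n) x) ≢ c x
  step zero          = alternating-≢2 (toℕ (fromℕ n))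
  step (suc zero)    = alternating-≢2 0 ∘ sym
  step (suc (suc x)) e = alternating-≢ (toℕ x) (trans (cong alternating (sym (toℕ-inject₁ x))) e)

-- Irreducibility of the cycle

arcs : ∀ {m} {S : (Fin m → Color) → Set} {kempe : KempeClosed S} →
       (∀ {φ} → S φ → Closed φ (allFin m)) → 5 ≤ m → ∀ {i k} → i ≢ k →
       ∃[ V ] ∃[ O ] Arcs S kempe i V k O × 3 ≤ length V + length O
arcs {m} {S} closed 5≤m {i} {k} i≢k with ∈-∃++ (∈-allFin i)
... | U , W , eq₁ with ∈-resp-↭ (↭-trans (↭-reflexive eq₁) (++-comm U (i ∷ W))) (∈-allFin k)
... | here refl = contradiction refl i≢k
... | there k∈ with ∈-∃++ k∈
... | V , O , eq₂ = V , O , record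
    { closed = λ {φ} s → subst (Closed φ) (cong (i ∷_) eq₂) (closed-rotate U (subst (Closed φ) eq₁ (closed s)))
    ; unique = Unique-resp-↭ perm (allFin⁺ m)
    } , long
  where
  perm : allFin m ↭ i ∷ V ++ k ∷ O
  perm = ↭-trans (↭-reflexive eq₁) (↭-trans (++-comm U (i ∷ W)) (↭-reflexive (cong (i ∷_) eq₂)))
  count : m ≡ suc (suc (length V + length O))
  count = trans (sym (length-tabulate id)) (trans (↭-length perm)
    (cong suc (trans (length-++ V) (+-suc (length V) (length O)))))
  -- At least five semiedges, less `i` and `k`.
  long : 3 ≤ length V + length O
  long with subst (5 ≤_) count 5≤m
  ... | s≤s (s≤s l) = l

AlwaysSame AlwaysDiffer : ∀ {m} (N : Multipole m) → Fin m → Fin m → Set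
AlwaysSame N i k   = ∀ (φ : TaitColoring N) → semiColor φ i ≡ semiColor φ k
AlwaysDiffer N i k = ∀ (φ : TaitColoring N) → semiColor φ i ≢ semiColor φ k

cherry-differs : ∀ {m} (N : Multipole m) {i k v} → i ≢ k →
                 attach N i ≡ inj₁ v → attach N k ≡ inj₁ v → AlwaysDiffer N i k
cherry-differs N {i} {k} {v} i≢k p q φ e with proper φ v {semi i p} {semi k q} e
... | refl = i≢k refl

linked-semiedges : ∀ {m} (N : Multipole m) → order N < m →
                   ∃[ i ] ∃[ k ] i ≢ k × (AlwaysSame N i k ⊎ AlwaysDiffer N i k)
linked-semiedges {m} N small with any? (λ i → any? λ j → attached? i j)
  where
  attached? : ∀ i j → Dec (attach N i ≡ inj₂ j)
  attached? i j with attach N i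
  ... | inj₁ _ = no λ ()
  ... | inj₂ k with k ≟ j
  ... | yes refl = yes refl
  ... | no k≢j   = no (k≢j ∘ inj₂-injective)
... | yes (i , j , at) = i , j , proj₁ (paired N i j at) , inj₁ (λ φ → free φ i j at)
... | no none = cherry
  where
  vertex : ∀ i → ∃[ v ] attach N i ≡ inj₁ v
  vertex i with attach N i in at
  ... | inj₁ v = v , refl
  ... | inj₂ j = contradiction (i , j , at) none
  cherry : ∃[ i ] ∃[ k ] i ≢ k × (AlwaysSame N i k ⊎ AlwaysDiffer N i k)
  cherry with pigeonhole small (proj₁ ∘ vertex)
  ... | i , k , i<k , e = i , k , <⇒≢ i<k , inj₂ (cherry-differs N (<⇒≢ i<k) (proj₂ (vertex i))
                            (trans (proj₂ (vertex k)) (cong inj₁ (sym e))))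

cycle-irreducible : ∀ n → 5 ≤ suc n → Irreducible (Cycle.cycle n)
cycle-irreducible n 5≤m (N , small , (s , φ₀ , _) , Col⊆) with linked-semiedges N small
... | i , k , i≢k , linked = refute linked
  where
  S : (Fin (suc n) → Color) → Set
  S f = ∃[ φ ] semiColor {M = N} φ ≡ f
  kempe : KempeClosed S
  kempe d j (φ , refl) moves with Kempe.kempe N φ d j moves
  ... | y , φ′ , flip = y , semiColor φ′ , flip , φ′ , refl
  closed : ∀ {f} → S f → Closed f (allFin (suc n))
  -- Each state of N is a state of the cycle, and its walk is transported along the pointwise
  -- equality of the two semiedge colorings.
  closed (φ , refl) with Col⊆ (φ , refl)
  ... | ψ , eq with Cycle.state-walk n ψ
  ... | b , w = b , walk-agree (λ {z} _ → trans (sym (lookup∘tabulate (semiColor ψ) z))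
                      (trans (cong (λ v → Vec.lookup v z) eq) (lookup∘tabulate (semiColor φ) z))) w
  refute : ¬ (AlwaysSame N i k ⊎ AlwaysDiffer N i k)
  refute with arcs {kempe = kempe} closed 5≤m i≢k
  ... | V , O , ar , long = λ where
    (inj₁ same)   → same⇒empty S kempe ar (λ where (φ , refl) → same φ) long (φ₀ , refl)
    (inj₂ differ) → differ⇒empty S kempe ar (λ where (φ , refl) → differ φ) long (φ₀ , refl)

mainTheorem6 : (m : ℕ) → 5 ≤ m →
    (∀ v → IsMaxOrder m v → m ≤ v) ×
    (∃[ M ] IrreducibleColorable {m} M × m ≤ order M)
mainTheorem6 (suc (suc n)) 5≤m = (λ v max → proj₂ max cycle witness) , cycle , witness , ≤-refl
  where
  open Cycle (suc n) using (cycle)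
  witness : IrreducibleColorable cycle
  witness = cycle-irreducible (suc n) 5≤m , cycle-colorable n
mainTheorem6 (suc zero) (s≤s ())
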